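{- In the comparison query model, there is an $\mathcal{O}(n)$-competitive algorithm for finding the $B$-optimal stable matching in a stable matching instance with one-sided uncertainty.
   Context: Two disjoint sets $A$, $B$ of agents with $|A|=|B|=n$. Each $a\in A$ has a strict total order $\prec_a$ on $B$ and each $b\in B$ has a strict total order $\prec_b$ on $A$ ($x\prec_y z$: $y$ prefers $x$ to $z$). A matching is a bijection between $A$ and $B$; it is stable if there is no pair $(a,b)$, $b\neq M(a)$, with $a$ preferring $b$ to $M(a)$ and $b$ preferring $a$ to $M(b)$. A stable matching is $B$-optimal if every agent of $B$ weakly prefers its partner in it to its partner in any other stable matching. One-sided uncertainty: the orders $\prec_a$ ($a\in A$) are known, the orders $\prec_b$ ($b\in B$) are unknown and learned only via queries. A comparison query $\mathit{prefer}(b,a_1,a_2)$ returns whichever of $a_1,a_2$ agent $b$ prefers. An algorithm queries adaptively until the known information proves its output correct (for every $B$-side preference profile consistent with the $A$-side preferences and the answers). It is $\rho$-competitive if on every instance its number of queries is at most $\rho$ times the minimum size of a query set whose answers on that instance suffice to prove the correct output. -}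

module Defs where

open import Data.Nat using (ℕ; _*_; _≤_)
open import Data.Fin using (Fin; toℕ)
import Data.Nat as ℕ
open import Data.Nat.Properties using (_<?_)
open import Data.Product using (Σ; _×_; _,_; proj₁; proj₂; ∃)
open import Data.Sum using (_⊎_)
open import Data.List using (List; []; _∷_; length)
open import Data.List.Relation.Unary.All using (All)
open import Relation.Nullary using (¬_; yes; no)
open import Relation.Binary.PropositionalEquality using (_≡_; _≢_)
open import Function.Bundles using (_↔_; Inverse)

-- A strict total order on a set of n agents (Fin n), given by its ranking:
-- a bijection rank : Fin n ↔ Fin n, where rank x = position of x in the order
-- (0 = most preferred).
Pref : ℕ → Set
Pref n = Fin n ↔ Fin n

_⊢_≺_ : ∀ {n} → Pref n → Fin n → Fin n → Set
P ⊢ x ≺ z = toℕ (Inverse.to P x) ℕ.< toℕ (Inverse.to P z)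

-- Preference profiles.  A-agents and B-agents are both indexed by Fin n.
ProfileA : ℕ → Set
ProfileA n = Fin n → Pref n      -- ≺_a on B for each a ∈ A

ProfileB : ℕ → Set
ProfileB n = Fin n → Pref n      -- ≺_b on A for each b ∈ B

-- A matching: a bijection A → B.  to M a = partner of a; from M b = partner of b.
Matching : ℕ → Set
Matching n = Fin n ↔ Fin n

Blocking : ∀ {n} → ProfileA n → ProfileB n → Matching n → Fin n → Fin n → Set
Blocking PA PB M a b =
  b ≢ Inverse.to M a
  × (PA a ⊢ b ≺ Inverse.to M a)
  × (PB b ⊢ a ≺ Inverse.from M b)

Stable : ∀ {n} → ProfileA n → ProfileB n → Matching n → Set
Stable PA PB M = ∀ a b → ¬ Blocking PA PB M a b

BOptimal : ∀ {n} → ProfileA n → ProfileB n → Matching n → Set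
BOptimal PA PB M =
  Stable PA PB M ×
  (∀ M' → Stable PA PB M' → ∀ b →
     Inverse.from M b ≡ Inverse.from M' b ⊎ (PB b ⊢ Inverse.from M b ≺ Inverse.from M' b))

record Query (n : ℕ) : Set where
  constructor prefer
  field
    b  : Fin n
    a₁ : Fin n
    a₂ : Fin n

answer : ∀ {n} → ProfileB n → Query n → Fin n
answer PB (prefer b a₁ a₂) with toℕ (Inverse.to (PB b) a₂) ℕ.<? toℕ (Inverse.to (PB b) a₁)
... | yes _ = a₂
... | no  _ = a₁

Agrees : ∀ {n} → List (Query n) → ProfileB n → ProfileB n → Set
Agrees qs PB PB' = All (λ q → answer PB' q ≡ answer PB q) qs

Suffices : ∀ {n} → ProfileA n → ProfileB n → List (Query n) → Set
Suffices PA PB qs = Σ (Matching _) λ M → ∀ PB' → Agrees qs PB PB' → BOptimal PA PB' M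

-- An adaptive query algorithm (for fixed n and known A-side preferences):
-- a finite decision tree that either stops with an output matching or asks
-- a query and continues depending on the answer.
data Strategy (n : ℕ) : Set where
  done : Matching n → Strategy n
  ask  : Query n → (Fin n → Strategy n) → Strategy n

run : ∀ {n} → Strategy n → ProfileB n → List (Query n) × Matching n
run (done M)  PB = [] , M
run (ask q k) PB with run (k (answer PB q)) PB
... | qs , M = q ∷ qs , M

queriesOf : ∀ {n} → Strategy n → ProfileB n → List (Query n)
queriesOf S PB = proj₁ (run S PB)

outputOf : ∀ {n} → Strategy n → ProfileB n → Matching n
outputOf S PB = proj₂ (run S PB)

Algorithm : Set
Algorithm = (n : ℕ) → ProfileA n → Strategy n

-- Correctness: when the algorithm stops, the known information (A-profile and
-- the answers obtained) proves the output to be the B-optimal stable matching.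
Correct : Algorithm → Set
Correct alg = ∀ n (PA : ProfileA n) (PB : ProfileB n) (PB' : ProfileB n) →
  Agrees (queriesOf (alg n PA) PB) PB PB' →
  BOptimal PA PB' (outputOf (alg n PA) PB)

-- ρ(n)-competitiveness with ρ(n) = c · n: on every instance the number of
-- queries is at most c · n times the size of any query set whose answers
-- suffice to prove the correct output (hence at most c · n · OPT).
CompetitiveLinear : ℕ → Algorithm → Set
CompetitiveLinear c alg = ∀ n (PA : ProfileA n) (PB : ProfileB n) (qs : List (Query n)) →
  Suffices PA PB qs →
  length (queriesOf (alg n PA) PB) ≤ c * n * length qs

{-# OPTIONS --safe #-}

-- Upper bound, O(n²) queries.  First the A-agents propose down their lists; while two of them
-- point at the same b, one query sends the loser to its next candidate.  The resulting stable M is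
-- then improved for B by rotations: the successor of a is the first b below M(a) that prefers a to
-- its partner, and a cycle of a ↦ M⁻¹(successor of a) yields a stable matching better for B.
-- The chain of successors is followed on a stack, which keeps its lower part when a cycle at its
-- top is eliminated, so that every query is paid for by a pointer advance or a status change.
-- An agent that has no successor, or whose successor's partner is final, is final: it is worse off
-- in no stable matching.  When all agents are final, M is A-pessimal, hence B-optimal.
--
-- Lower bound, n - 1 queries.  If two agents of B are never queried, they may both rank their
-- partners last; then every a has a successor, so a rotation exists and M is not B-optimal.
module Submission where

open import Defs
open import Data.Empty using (⊥-elim)
open import Data.Bool using (if_then_else_)
open import Data.Fin using (Fin; zero; suc; toℕ; fromℕ; fromℕ<; punchOut)
open import Data.Fin.Permutation using (transpose)
open import Data.Fin.Properties using
  (_≟_; any?; toℕ-injective; toℕ<n; toℕ≤pred[n]; toℕ-fromℕ; toℕ-fromℕ<; punchOut-injective;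
   pigeonhole; injective⇒≤; <⇒notInjective)
open import Data.List using (List; []; _∷_; _++_; length; map; drop; tabulate)
open import Data.List.Membership.Propositional using (_∈_; _∉_)
open import Data.List.Membership.Propositional.Properties using (∈-map⁺; ∈-++⁺ˡ; ∈-++⁺ʳ; ∈-++⁻; ∈-∃++)
open import Data.List.Membership.Setoid.Properties using (index-injective)
open import Data.List.Properties using (length-map; ++-assoc)
open import Data.List.Relation.Unary.All as All using (All; []; _∷_)
open import Data.List.Relation.Unary.All.Properties using (All¬⇒¬Any; ¬Any⇒All¬)
open import Data.List.Relation.Unary.AllPairs using ([]; _∷_)
open import Data.List.Relation.Unary.Any using (here; there; index)
open import Data.List.Relation.Unary.Linked as Linked using (Linked; []; [-]; _∷_)
open import Data.List.Relation.Unary.Unique.Propositional using (Unique)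
open import Data.Nat using (ℕ; zero; suc; _+_; _*_; _∸_; _≤_; _<_; z≤n; s≤s; s≤s⁻¹; >-nonZero)
open import Data.Nat.ListAction using (sum)
open import Data.Nat.Properties hiding (_≟_)
open import Data.Product using (Σ; ∃; _×_; _,_; proj₁; proj₂)
open import Data.Sum using (_⊎_; inj₁; inj₂)
open import Function using (_∘_; const; Injective)
open import Function.Bundles using (Inverse; _↔_; mk↔ₛ′)
open import Function.Construct.Identity using (↔-id)
open import Relation.Binary using (tri<; tri≈; tri>)
open import Relation.Binary.PropositionalEquality using
  (_≡_; _≢_; refl; sym; trans; cong; cong₂; subst; subst₂; setoid; module ≡-Reasoning)
open import Relation.Nullary using (¬_; Dec; yes; no; does; contradiction)
open import Relation.Nullary.Decidable using (dec-true; dec-false; decidable-stable; ¬?; _×-dec_)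
open import Relation.Unary using (Decidable)
import Data.List.Membership.DecPropositional as DecMembership

open Inverse using (to; from; strictlyInverseˡ; strictlyInverseʳ)

-- Injections and permutations of a finite set.

module _ {n : ℕ} where

  -- A missed value could be removed from the codomain, leaving an injection into a smaller set.
  injective⇒surjective : {f : Fin n → Fin n} → Injective _≡_ _≡_ f → ∀ y → ∃ λ x → f x ≡ y
  injective⇒surjective {f} inj y with any? (λ x → f x ≟ y)
  ... | yes hit = hit
  ... | no miss = ⊥-elim (avoiding y miss inj)
    where
    avoiding : ∀ {m} {g : Fin m → Fin m} y → ¬ ∃ (λ x → g x ≡ y) → ¬ Injective _≡_ _≡_ g
    avoiding {suc m} y miss inj =
      <⇒notInjective (n<1+n m)
        (λ {_} {_} → inj ∘ punchOut-injective (λ eq → miss (_ , sym eq)) (λ eq → miss (_ , sym eq)))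

  -- A section of f is injective, hence onto, so every point is a value of the section, and f is
  -- injective on those.
  surjective⇒injective : {f : Fin n → Fin n} → (∀ y → ∃ λ x → f x ≡ y) → Injective _≡_ _≡_ f
  surjective⇒injective {f} surj {x} {x′} fx≡fx′ =
    trans (sym x-hit) (trans (cong section same) x′-hit)
    where
    section : Fin n → Fin n
    section = proj₁ ∘ surj
    section-injective : Injective _≡_ _≡_ section
    section-injective eq = trans (sym (proj₂ (surj _))) (trans (cong f eq) (proj₂ (surj _)))
    x-hit = proj₂ (injective⇒surjective section-injective x)
    x′-hit = proj₂ (injective⇒surjective section-injective x′)
    same = trans (sym (proj₂ (surj _))) (trans (cong f x-hit)
             (trans fx≡fx′ (trans (cong f (sym x′-hit)) (proj₂ (surj _)))))

  bijection : {f : Fin n → Fin n} → Injective _≡_ _≡_ f → Fin n ↔ Fin n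
  bijection {f} inj = mk↔ₛ′ f (proj₁ ∘ surj) (proj₂ ∘ surj) (λ x → inj (proj₂ (surj (f x))))
    where surj = injective⇒surjective inj

  to-injective : (M : Fin n ↔ Fin n) → Injective _≡_ _≡_ (to M)
  to-injective M {x} {y} eq =
    trans (sym (strictlyInverseʳ M x)) (trans (cong (from M) eq) (strictlyInverseʳ M y))

  from-to : (M : Fin n ↔ Fin n) {x y : Fin n} → to M x ≡ y → from M y ≡ x
  from-to M {x} eq = trans (cong (from M) (sym eq)) (strictlyInverseʳ M x)

  override : ∀ {A : Set} {R : Fin n → Set} → Decidable R → (Fin n → A) → (Fin n → A) → Fin n → A
  override R? f g x = if does (R? x) then f x else g x

  module _ {A : Set} {R : Fin n → Set} (R? : Decidable R) (f g : Fin n → A) {x : Fin n} where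

    override-in : R x → override R? f g x ≡ f x
    override-in r rewrite dec-true (R? x) r = refl

    override-out : ¬ R x → override R? f g x ≡ g x
    override-out ¬r rewrite dec-false (R? x) ¬r = refl

  -- A set mapped into itself by an injection f is mapped onto itself: otherwise f on R,
  -- extended by the identity, would still be injective but not surjective.
  closed⇒onto : {R : Fin n → Set} (R? : Decidable R) {f : Fin n → Fin n} → Injective _≡_ _≡_ f →
                (∀ {x} → R x → R (f x)) → ∀ {y} → R y → ∃ λ x → R x × f x ≡ y
  closed⇒onto {R} R? {f} inj closed {y} ry with injective⇒surjective inj′ y
    where
    g : Fin n → Fin n
    g = override R? f (λ x → x)
    inj′ : Injective _≡_ _≡_ g
    inj′ {x} {x′} eq with R? x | R? x′
    ... | yes _ | yes _ = inj eq
    ... | yes r | no ¬r′ = contradiction (subst R eq (closed r)) ¬r′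
    ... | no ¬r | yes r′ = contradiction (subst R (sym eq) (closed r′)) ¬r
    ... | no _ | no _ = eq
  ... | x , gx≡y with R? x
  ...   | yes r = x , r , gx≡y
  ...   | no ¬r = contradiction (subst R (sym gx≡y) ry) ¬r

  ≺-irrefl : (P : Pref n) {x : Fin n} → ¬ (P ⊢ x ≺ x)
  ≺-irrefl P = <-irrefl refl

  ≺-connex : (P : Pref n) {x y : Fin n} → x ≢ y → ¬ (P ⊢ x ≺ y) → P ⊢ y ≺ x
  ≺-connex P x≢y x⊀y = ≤∧≢⇒< (≮⇒≥ x⊀y) (λ eq → x≢y (sym (to-injective P (toℕ-injective eq))))

-- Stable matchings and rotations

module StableMatchings {n : ℕ} (PA : ProfileA n) (PB : ProfileB n) where

  WorseFor : Matching n → Matching n → Fin n → Set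
  WorseFor M M′ a = PA a ⊢ to M a ≺ to M′ a

  module _ (M M′ : Matching n) (M-stable : Stable PA PB M) (M′-stable : Stable PA PB M′) where

    -- Otherwise a and `to M a` would block M′.
    partner-better : ∀ {a} → WorseFor M M′ a → PB (to M a) ⊢ from M′ (to M a) ≺ a
    partner-better {a} worse = ≺-connex (PB (to M a)) a≢ (λ a≺ → M′-stable a (to M a) (b≢ , worse , a≺))
      where
      b≢ : to M a ≢ to M′ a
      b≢ eq = ≺-irrefl (PA a) (subst (PA a ⊢ to M a ≺_) (sym eq) worse)
      a≢ : a ≢ from M′ (to M a)
      a≢ eq = b≢ (trans (sym (strictlyInverseˡ M′ (to M a))) (cong (to M′) (sym eq)))

    -- Otherwise b and its partner in M′ would block M.
    new-partner-worse : ∀ {b} → PB b ⊢ from M′ b ≺ from M b → WorseFor M M′ (from M′ b)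
    new-partner-worse {b} better =
      subst (PA a ⊢ to M a ≺_) (sym (strictlyInverseˡ M′ b))
        (≺-connex (PA a) b≢ (λ b≺ → M-stable a b (b≢ , b≺ , better)))
      where
      a = from M′ b
      b≢ : b ≢ to M a
      b≢ eq = ≺-irrefl (PB b) (subst (PB b ⊢ a ≺_) (from-to M (sym eq)) better)

    -- The agents worse off in M′ are permuted by a ↦ M′⁻¹ (M a).
    displaced-worse : ∀ {a} → WorseFor M M′ a → WorseFor M M′ (from M (to M′ a))
    displaced-worse {a} worse
      with closed⇒onto (λ x → toℕ (to (PA x) (to M x)) <? toℕ (to (PA x) (to M′ x)))
             {f = from M′ ∘ to M} σ-injective (new-partner-worse ∘ σ-better) worse
      where
      σ-injective : Injective _≡_ _≡_ (from M′ ∘ to M)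
      σ-injective eq = to-injective M
        (trans (sym (strictlyInverseˡ M′ _)) (trans (cong (to M′) eq) (strictlyInverseˡ M′ _)))
      σ-better : ∀ {x} → WorseFor M M′ x → PB (to M x) ⊢ from M′ (to M x) ≺ from M (to M x)
      σ-better {x} w = subst (PB (to M x) ⊢ _ ≺_) (sym (strictlyInverseʳ M x)) (partner-better w)
    ... | x , x-worse , refl =
      subst (WorseFor M M′) (sym (from-to M (sym (strictlyInverseˡ M′ (to M x))))) x-worse

    old-partner-worse : ∀ {b} → PB b ⊢ from M′ b ≺ from M b → WorseFor M M′ (from M b)
    old-partner-worse {b} better =
      subst (WorseFor M M′ ∘ from M) (strictlyInverseˡ M′ b) (displaced-worse (new-partner-worse better))

    -- The agent matched in M to `to M′ a` is worse off too, and `partner-better` is applied to it.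
    -- Hence a stable matching can demote a only to an agent that accepts a.
    next-partner-better : ∀ {a} → WorseFor M M′ a → PB (to M′ a) ⊢ a ≺ from M (to M′ a)
    next-partner-better {a} worse = subst₂ (λ b x → PB b ⊢ x ≺ c) (strictlyInverseˡ M (to M′ a))
        (from-to M′ (sym (strictlyInverseˡ M (to M′ a)))) (partner-better (displaced-worse worse))
      where c = from M (to M′ a)

  -- This depends on M only through `to M a`, so it survives every rotation that leaves a in place.
  Final : Matching n → Fin n → Set
  Final M a = ∀ M′ → Stable PA PB M′ → ¬ WorseFor M M′ a

  -- If some b did better in another stable matching, its partner in M would be worse off there.
  all-final⇒BOptimal : ∀ M → Stable PA PB M → (∀ a → Final M a) → BOptimal PA PB M
  all-final⇒BOptimal M M-stable final = M-stable , decide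
    where
    decide : ∀ M′ → Stable PA PB M′ → ∀ b → from M b ≡ from M′ b ⊎ (PB b ⊢ from M b ≺ from M′ b)
    decide M′ M′-stable b with from M b ≟ from M′ b
    ... | yes eq = inj₁ eq
    ... | no neq = inj₂ (≺-connex (PB b) (neq ∘ sym)
                     (final _ M′ M′-stable ∘ old-partner-worse M M′ M-stable M′-stable))

  exhausted⇒final : ∀ M {a} → Stable PA PB M →
                    (∀ b → PA a ⊢ to M a ≺ b → PB b ⊢ from M b ≺ a) → Final M a
  exhausted⇒final M M-stable rejected M′ M′-stable worse =
    <-asym (rejected _ worse) (next-partner-better M M′ M-stable M′-stable worse)

  -- Let a be worse off in M′. It cannot land before b, where it is rejected. Landing at b, it
  -- displaces the partner of b. Landing beyond b, it would block with b unless b improves even on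
  -- a, so the partner of b is worse off again, against its finality.
  successor-final⇒final : ∀ M {a b} → Stable PA PB M →
    (∀ y → PA a ⊢ to M a ≺ y → PA a ⊢ y ≺ b → PB y ⊢ from M y ≺ a) →
    PB b ⊢ a ≺ from M b → Final M (from M b) → Final M a
  successor-final⇒final M {a} {b} M-stable rejected accepted final M′ M′-stable worse
    with b ≟ to M′ a
  ... | yes refl = final M′ M′-stable (displaced-worse M M′ M-stable M′-stable worse)
  ... | no b≢ with toℕ (to (PA a) (to M′ a)) <? toℕ (to (PA a) b)
  ...   | yes M′a≺b = <-asym (rejected _ worse M′a≺b) (next-partner-better M M′ M-stable M′-stable worse)
  ...   | no M′a⊀b = final M′ M′-stable (old-partner-worse M M′ M-stable M′-stable better)
    where
    a≢ : a ≢ from M′ b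
    a≢ eq = b≢ (trans (sym (strictlyInverseˡ M′ b)) (cong (to M′) (sym eq)))
    better : PB b ⊢ from M′ b ≺ from M b
    better = <-trans (≺-connex (PB b) a≢ (λ a≺ → M′-stable a b (b≢ , ≺-connex (PA a) (b≢ ∘ sym) M′a⊀b , a≺)))
                     accepted

  -- R may be a union of several cycles: `suitor` says that s maps R onto the partners of R, each of
  -- which prefers its new agent.
  record Rotation (M : Matching n) (R : Fin n → Set) (s : Fin n → Fin n) : Set where
    field
      rejected : ∀ {a} → R a → ∀ b → PA a ⊢ to M a ≺ b → PA a ⊢ b ≺ s a → PB b ⊢ from M b ≺ a
      suitor   : ∀ {a} → R a → ∃ λ x → R x × s x ≡ to M a × PB (to M a) ⊢ x ≺ a

  module _ (M : Matching n) {R : Fin n → Set} (R? : Decidable R) {s : Fin n → Fin n}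
           (rotation : Rotation M R s) where
    open Rotation rotation

    rotated-injective : Injective _≡_ _≡_ (override R? s (to M))
    rotated-injective = surjective⇒injective λ b → onto b (R? (from M b))
      where
      onto : ∀ b → Dec (R (from M b)) → ∃ λ x → override R? s (to M) x ≡ b
      onto b (no ¬r) = from M b , trans (override-out R? s (to M) ¬r) (strictlyInverseˡ M b)
      onto b (yes r) with suitor r
      ... | x , rx , sx≡ , _ = x , trans (override-in R? s (to M) rx) (trans sx≡ (strictlyInverseˡ M b))

    -- M′ is given by a pointwise equation because the algorithm builds its matching without access
    -- to the profile, hence without a `Rotation` proof.
    module _ (M′ : Matching n) (rotated : ∀ a → to M′ a ≡ override R? s (to M) a) where

      rotated-better : ∀ {a} → R a → PB (to M a) ⊢ from M′ (to M a) ≺ a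
      rotated-better r with suitor r
      ... | x , rx , sx≡ , x≺ =
        subst (λ y → PB _ ⊢ y ≺ _) (sym (from-to M′ (trans (rotated x) (trans (override-in R? s (to M) rx) sx≡)))) x≺

      rotated-weakly-better : ∀ b → from M′ b ≡ from M b ⊎ (PB b ⊢ from M′ b ≺ from M b)
      rotated-weakly-better b with R? (from M b)
      ... | no ¬r = inj₁ (from-to M′ (trans (rotated _) (trans (override-out R? s (to M) ¬r) (strictlyInverseˡ M b))))
      ... | yes r = inj₂ (subst (λ y → PB y ⊢ from M′ y ≺ from M b) (strictlyInverseˡ M b) (rotated-better r))

      rotated-prefers : ∀ {b x} → PB b ⊢ x ≺ from M′ b → PB b ⊢ x ≺ from M b
      rotated-prefers {b} {x} x≺ with rotated-weakly-better b
      ... | inj₁ eq = subst (PB b ⊢ x ≺_) eq x≺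
      ... | inj₂ better = <-trans x≺ better

      rotated-rejects : ∀ {b x} → PB b ⊢ from M b ≺ x → PB b ⊢ from M′ b ≺ x
      rotated-rejects {b} {x} ≺x with rotated-weakly-better b
      ... | inj₁ eq = subst (PB b ⊢_≺ x) (sym eq) ≺x
      ... | inj₂ better = <-trans better ≺x

      -- Partners of B-agents only improve, so y of a blocking pair also prefers x to its old
      -- partner. If x did not move, the pair blocks M. If x moved, y comes before the old partner
      -- of x and blocks M, or is that partner, which is absurd, or lies between the old and the new
      -- one and has rejected x.
      rotated-stable : Stable PA PB M → Stable PA PB M′
      rotated-stable M-stable x y (y≢ , y≺ , x≺) with R? x
      ... | no ¬r = M-stable x y
              (y≢ ∘ (λ eq → trans eq (sym same)) , subst (PA x ⊢ y ≺_) same y≺ , rotated-prefers x≺)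
        where same = trans (rotated x) (override-out R? s (to M) ¬r)
      ... | yes r with <-cmp (toℕ (to (PA x) y)) (toℕ (to (PA x) (to M x)))
      ...   | tri< y≺Mx _ _ = M-stable x y ((λ { refl → ≺-irrefl (PA x) y≺Mx }) , y≺Mx , rotated-prefers x≺)
      ...   | tri≈ _ eq _ =
              ≺-irrefl (PB y) (subst (PB y ⊢ x ≺_) (from-to M (sym (to-injective (PA x) (toℕ-injective eq))))
                (rotated-prefers x≺))
      ...   | tri> _ _ Mx≺y =
              <-asym (rotated-prefers x≺) (rejected r y Mx≺y
                (subst (PA x ⊢ y ≺_) (trans (rotated x) (override-in R? s (to M) r)) y≺))

      rotation⇒¬BOptimal : ∀ {c} → R c → ¬ BOptimal PA PB M
      rotation⇒¬BOptimal {c} r (M-stable , best) with best M′ (rotated-stable M-stable) (to M c)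
      ... | inj₁ eq = ≺-irrefl (PB (to M c))
              (subst (λ x → PB (to M c) ⊢ x ≺ c) (trans (sym eq) (strictlyInverseʳ M c)) (rotated-better r))
      ... | inj₂ worse = <-asym (rotated-better r)
              (subst (λ x → PB (to M c) ⊢ x ≺ from M′ (to M c)) (strictlyInverseʳ M c) worse)

-- The lower bound

iterate : {A : Set} → (A → A) → ℕ → A → A
iterate f zero x = x
iterate f (suc k) x = f (iterate f k x)

iterate-+ : {A : Set} (f : A → A) (j k : ℕ) (x : A) → iterate f (j + k) x ≡ iterate f j (iterate f k x)
iterate-+ f zero k x = refl
iterate-+ f (suc j) k x = cong f (iterate-+ f j k x)

module _ {n : ℕ} where

  open DecMembership (_≟_ {n}) using (_∈?_)

  -- The period `suc (toℕ k)` is positive and at most n, which makes the predicate decidable.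
  Periodic : (Fin n → Fin n) → Fin n → Set
  Periodic f x = ∃ λ (k : Fin n) → iterate f (suc (toℕ k)) x ≡ x

  periodic? : ∀ f → Decidable (Periodic f)
  periodic? f x = any? (λ k → iterate f (suc (toℕ k)) x ≟ x)

  -- The last point of the orbit before it returns to x is a periodic preimage of x. This is the
  -- source of the suitors.
  periodic-preimage : ∀ f {x} → Periodic f x → ∃ λ y → Periodic f y × f y ≡ x
  periodic-preimage f {x} (k , eq) = iterate f (toℕ k) x , (k , again) , eq
    where
    again : iterate f (suc (toℕ k)) (iterate f (toℕ k) x) ≡ iterate f (toℕ k) x
    again = begin
      iterate f (suc (toℕ k)) (iterate f (toℕ k) x) ≡⟨ iterate-+ f (suc (toℕ k)) (toℕ k) x ⟨
      iterate f (suc (toℕ k) + toℕ k) x             ≡⟨ cong (λ m → iterate f m x) (+-comm (suc (toℕ k)) (toℕ k)) ⟩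
      iterate f (toℕ k + suc (toℕ k)) x             ≡⟨ iterate-+ f (toℕ k) (suc (toℕ k)) x ⟩
      iterate f (toℕ k) (iterate f (suc (toℕ k)) x) ≡⟨ cong (iterate f (toℕ k)) eq ⟩
      iterate f (toℕ k) x ∎
      where open ≡-Reasoning

  least : {P : Fin n → Set} → Decidable P → ∃ P → ∃ λ i → P i × (∀ j → toℕ j < toℕ i → ¬ P j)
  least P? nonempty = go P? nonempty
    where
    go : ∀ {m} {P : Fin m → Set} → Decidable P → ∃ P → ∃ λ i → P i × (∀ j → toℕ j < toℕ i → ¬ P j)
    go {suc m} P? (i , pi) with P? zero
    ... | yes p₀ = zero , p₀ , λ _ ()
    go {suc m} P? (zero , p₀) | no ¬p₀ = contradiction p₀ ¬p₀
    go {suc m} P? (suc i , pi) | no ¬p₀ with go (P? ∘ suc) (i , pi)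
    ... | j , pj , minimal = suc j , pj , λ { zero _ → ¬p₀ ; (suc k) (s≤s k<j) → minimal k k<j }

  most-preferred : (P : Pref n) {Q : Fin n → Set} → Decidable Q → ∃ Q →
                   ∃ λ x → Q x × (∀ y → P ⊢ y ≺ x → ¬ Q y)
  most-preferred P {Q} Q? (x , qx)
    with least (Q? ∘ from P) (to P x , subst Q (sym (strictlyInverseʳ P x)) qx)
  ... | i , qi , minimal = from P i , qi , λ y y≺ qy →
    minimal (to P y) (subst (λ j → toℕ (to P y) < toℕ j) (strictlyInverseˡ P i) y≺)
      (subst Q (sym (strictlyInverseʳ P y)) qy)

  missing : (xs : List (Fin n)) → length xs < n → ∃ λ x → x ∉ xs
  missing xs short with any? (λ x → ¬? (x ∈? xs))
  ... | yes found = found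
  ... | no none = contradiction (injective⇒≤ {f = λ x → index (covered x)}
                    (λ {x} {y} → index-injective (setoid _) (covered x) (covered y))) (<⇒≱ short)
    where
    covered : ∀ x → x ∈ xs
    covered x = decidable-stable (x ∈? xs) (λ x∉ → none (x , x∉))

  two-missing : (xs : List (Fin n)) → suc (length xs) < n →
                ∃ λ x → ∃ λ y → x ≢ y × x ∉ xs × y ∉ xs
  two-missing xs short with missing xs (<-trans (n<1+n (length xs)) short)
  ... | x , x∉ with missing (x ∷ xs) short
  ...   | y , y∉ = x , y , (λ x≡y → y∉ (here (sym x≡y))) , x∉ , y∉ ∘ there

-- Among the iterates 0 to n two coincide, say i < j; the i-th then has period j - i, written
-- `suc d`.
periodic-point : ∀ {n} (f : Fin n → Fin n) → Fin n → ∃ (Periodic f)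
periodic-point {n} f x with pigeonhole (n<1+n n) (λ (i : Fin (suc n)) → iterate f (toℕ i) x)
... | i , j , i<j , eq = iterate f (toℕ i) x , k , periodic
  where
  gap : ∃ λ d → suc (toℕ i) + d ≡ toℕ j
  gap = m≤n⇒∃[o]m+o≡n i<j
  d = proj₁ gap
  d<n : d < n
  d<n = ≤-trans (s≤s (m≤n+m d (toℕ i))) (subst (_≤ n) (sym (proj₂ gap)) (toℕ≤pred[n] j))
  k : Fin n
  k = fromℕ< d<n
  periodic : iterate f (suc (toℕ k)) (iterate f (toℕ i) x) ≡ iterate f (toℕ i) x
  periodic = begin
    iterate f (suc (toℕ k)) (iterate f (toℕ i) x) ≡⟨ iterate-+ f (suc (toℕ k)) (toℕ i) x ⟨
    iterate f (suc (toℕ k + toℕ i)) x             ≡⟨ cong (λ m → iterate f (suc (m + toℕ i)) x) (toℕ-fromℕ< d<n) ⟩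
    iterate f (suc (d + toℕ i)) x                 ≡⟨ cong (λ m → iterate f (suc m) x) (+-comm d (toℕ i)) ⟩
    iterate f (suc (toℕ i + d)) x                 ≡⟨ cong (λ m → iterate f m x) (proj₂ gap) ⟩
    iterate f (toℕ j) x                           ≡⟨ eq ⟨
    iterate f (toℕ i) x ∎
    where open ≡-Reasoning

ranking-last : ∀ {n} (a : Fin n) → ∃ λ (P : Pref n) → ∀ x → x ≢ a → P ⊢ x ≺ a
ranking-last {suc m} a = P , λ x x≢a →
    subst (toℕ (to P x) <_) (sym (trans (cong toℕ last) (toℕ-fromℕ m)))
      (≤∧≢⇒< (toℕ≤pred[n] (to P x))
        (λ eq → x≢a (to-injective P (toℕ-injective (trans eq (sym (trans (cong toℕ last) (toℕ-fromℕ m))))))))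
  where
  P = transpose a (fromℕ m)
  last : to P a ≡ fromℕ m
  last rewrite dec-true (a ≟ a) refl = refl

-- The function `answer` in terms of the one ranking it consults, so that equal rankings give equal
-- answers by congruence.
choose : ∀ {n} → Pref n → Fin n → Fin n → Fin n
choose P a₁ a₂ with toℕ (to P a₂) <? toℕ (to P a₁)
... | yes _ = a₂
... | no _  = a₁

answer≡choose : ∀ {n} (PB : ProfileB n) (b a₁ a₂ : Fin n) → answer PB (prefer b a₁ a₂) ≡ choose (PB b) a₁ a₂
answer≡choose PB b a₁ a₂ with toℕ (to (PB b) a₂) <? toℕ (to (PB b) a₁)
... | yes _ = refl
... | no _ = refl

answer-local : ∀ {n} {PB PB′ : ProfileB n} (q : Query n) →
               PB′ (Query.b q) ≡ PB (Query.b q) → answer PB′ q ≡ answer PB q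
answer-local {PB = PB} {PB′} (prefer b a₁ a₂) eq =
  trans (answer≡choose PB′ b a₁ a₂) (trans (cong (λ P → choose P a₁ a₂) eq) (sym (answer≡choose PB b a₁ a₂)))

module _ {n : ℕ} (PA : ProfileA n) where

  open DecMembership (_≟_ {n}) using (_∈?_)

  module _ (PB : ProfileB n) (M : Matching n) where

    open StableMatchings PA PB

    -- The successor of a is the most preferred b with this property.
    Acceptable : Fin n → Fin n → Set
    Acceptable a b = PA a ⊢ to M a ≺ b × PB b ⊢ a ≺ from M b

    acceptable? : ∀ a → Decidable (Acceptable a)
    acceptable? a b = (toℕ (to (PA a) (to M a)) <? toℕ (to (PA a) b))
                      ×-dec (toℕ (to (PB b) a) <? toℕ (to (PB b) (from M b)))

    -- The map `from M ∘ s` sends its periodic points onto themselves. All its cycles are rotated at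
    -- once.
    periodic-rotation : (s : Fin n → Fin n) → (∀ a → Acceptable a (s a)) →
                        (∀ a b → PA a ⊢ b ≺ s a → ¬ Acceptable a b) →
                        Rotation M (Periodic (from M ∘ s)) s
    periodic-rotation s acceptable first = record { rejected = λ _ → rejected ; suitor = suitor }
      where
      rejected : ∀ {a} b → PA a ⊢ to M a ≺ b → PA a ⊢ b ≺ s a → PB b ⊢ from M b ≺ a
      rejected {a} b Ma≺b b≺s = ≺-connex (PB b)
        (λ a≡ → ≺-irrefl (PA a) (subst (PA a ⊢_≺ b) (trans (cong (to M) a≡) (strictlyInverseˡ M b)) Ma≺b))
        (λ a≺ → first a b b≺s (Ma≺b , a≺))
      suitor : ∀ {a} → Periodic (from M ∘ s) a →
               ∃ λ x → Periodic (from M ∘ s) x × s x ≡ to M a × PB (to M a) ⊢ x ≺ a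
      suitor {a} p with periodic-preimage (from M ∘ s) p
      ... | x , px , Msx≡a = x , px , sx≡Ma ,
        subst₂ (λ b y → PB b ⊢ x ≺ y) sx≡Ma Msx≡a (proj₂ (acceptable x))
        where
        sx≡Ma : s x ≡ to M a
        sx≡Ma = trans (sym (strictlyInverseˡ M (s x))) (cong (to M) Msx≡a)

    successors⇒¬BOptimal : Fin n → (∀ a → ∃ (Acceptable a)) → ¬ BOptimal PA PB M
    successors⇒¬BOptimal a₀ successor =
      rotation⇒¬BOptimal M (periodic? f) rotation (bijection (rotated-injective M (periodic? f) rotation))
        (λ _ → refl) (proj₂ (periodic-point f a₀))
      where
      first : ∀ a → ∃ λ b → Acceptable a b × (∀ y → PA a ⊢ y ≺ b → ¬ Acceptable a y)
      first a = most-preferred (PA a) (acceptable? a) (successor a)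
      f : Fin n → Fin n
      f = from M ∘ proj₁ ∘ first
      rotation : Rotation M (Periodic f) (proj₁ ∘ first)
      rotation = periodic-rotation (proj₁ ∘ first) (proj₁ ∘ proj₂ ∘ first) (proj₂ ∘ proj₂ ∘ first)

  -- Stability of M for PB′ forces every a to prefer its partner to whichever of b₁ and b₂ is not it.
  Suffices⇒n≤1+length : (PB : ProfileB n) (qs : List (Query n)) → Suffices PA PB qs → n ≤ suc (length qs)
  Suffices⇒n≤1+length PB qs (M , certified) with suc (length qs) <? n
  ... | no long = ≮⇒≥ long
  ... | yes short with two-missing (map Query.b qs) (subst (λ m → suc m < n) (sym (length-map Query.b qs)) short)
  ...   | b₁ , b₂ , b₁≢b₂ , b₁∉ , b₂∉ = ⊥-elim (successors⇒¬BOptimal PB′ M b₁ successor optimal)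
    where
    special? : Decidable (_∈ b₁ ∷ b₂ ∷ [])
    special? b = b ∈? (b₁ ∷ b₂ ∷ [])
    demoted : ProfileB n
    demoted b = proj₁ (ranking-last (from M b))
    PB′ : ProfileB n
    PB′ = override special? demoted PB
    agrees : Agrees qs PB PB′
    agrees = All.tabulate λ {q} q∈ → answer-local {PB = PB} {PB′ = PB′} q
      (override-out special? demoted PB {Query.b q}
      λ { (here refl) → b₁∉ (∈-map⁺ Query.b q∈) ; (there (here refl)) → b₂∉ (∈-map⁺ Query.b q∈) })
    optimal : BOptimal PA PB′ M
    optimal = certified PB′ agrees
    accept : ∀ {a b} → b ∈ b₁ ∷ b₂ ∷ [] → b ≢ to M a → PA a ⊢ to M a ≺ b × PB′ b ⊢ a ≺ from M b
    accept {a} {b} special b≢ = ≺-connex (PA a) b≢ (λ b≺ → proj₁ optimal a b (b≢ , b≺ , a≺)) , a≺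
      where
      a≺ : PB′ b ⊢ a ≺ from M b
      a≺ = subst (_⊢ a ≺ from M b) (sym (override-in special? demoted PB special))
             (proj₂ (ranking-last (from M b)) a (λ a≡ →
               b≢ (trans (sym (strictlyInverseˡ M b)) (cong (to M) (sym a≡)))))
    successor : ∀ a → ∃ λ b → PA a ⊢ to M a ≺ b × PB′ b ⊢ a ≺ from M b
    successor a with b₁ ≟ to M a
    ... | no b₁≢ = b₁ , accept (here refl) b₁≢
    ... | yes b₁≡ = b₂ , accept (there (here refl)) (λ b₂≡ → b₁≢b₂ (trans b₁≡ (sym b₂≡)))

-- Query strategies by bounded search

module _ {A : Set} where

  -- The head never occurs as the second member of a link, hence `drop 1`: since `Follows` reads
  -- only the pointer of the lower entry, the pointer at the top of the stack may advance freely.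
  linked-map : {R S : A → A → Set} {xs : List A} →
               (∀ {x y} → x ∈ xs → y ∈ drop 1 xs → R x y → S x y) → Linked R xs → Linked S xs
  linked-map f [] = []
  linked-map f [-] = [-]
  linked-map f (r ∷ rs) = f (here refl) (here refl) r ∷ linked-map (λ x∈ y∈ → f (there x∈) (there y∈)) rs

  linked-all : {R : A → A → Set} {P : A → Set} → (∀ {x y} → R x y → P y) →
               ∀ {x xs} → P x → Linked R (x ∷ xs) → All P (x ∷ xs)
  linked-all f px [-] = px ∷ []
  linked-all f px (r ∷ rs) = px ∷ linked-all f (f r) rs

  -- Along the stack this finds the entry pointing at the partner of x, except when x is the bottom
  -- c of the cycle.
  linked-next : {R : A → A → Set} → ∀ ps {c qs} → Linked R (ps ++ c ∷ qs) →
                ∀ {x} → x ∈ ps ++ c ∷ [] → x ≡ c ⊎ ∃ λ y → y ∈ ps ++ c ∷ [] × R x y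
  linked-next [] _ (here refl) = inj₁ refl
  linked-next (p ∷ []) (r ∷ rs) (here refl) = inj₂ (_ , there (here refl) , r)
  linked-next (p ∷ p′ ∷ ps) (r ∷ rs) (here refl) = inj₂ (_ , there (here refl) , r)
  linked-next (p ∷ ps) rs (there x∈) with linked-next ps (Linked.tail rs) x∈
  ... | inj₁ eq = inj₁ eq
  ... | inj₂ (y , y∈ , r) = inj₂ (y , there y∈ , r)

  linked-suffix : {R : A → A → Set} → ∀ xs {ys} → Linked R (xs ++ ys) → Linked R ys
  linked-suffix [] rs = rs
  linked-suffix (x ∷ xs) rs = linked-suffix xs (Linked.tail rs)

  unique-suffix : ∀ xs {ys : List A} → Unique (xs ++ ys) → Unique ys
  unique-suffix [] u = u
  unique-suffix (x ∷ xs) (_ ∷ u) = unique-suffix xs u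

  unique-disjoint : ∀ xs {ys : List A} → Unique (xs ++ ys) → ∀ {x} → x ∈ xs → x ∉ ys
  unique-disjoint (x ∷ xs) (x# ∷ u) (here refl) x∈ys = All¬⇒¬Any x# (∈-++⁺ʳ xs x∈ys)
  unique-disjoint (x ∷ xs) (x# ∷ u) (there x∈) = unique-disjoint xs u x∈

  drop1⊆ : ∀ {xs : List A} {x} → x ∈ drop 1 xs → x ∈ xs
  drop1⊆ {_ ∷ _} = there

-- Sums over all agents, for the potential.

total : ∀ {n} → (Fin n → ℕ) → ℕ
total f = sum (tabulate f)

total-mono-≤ : ∀ {n} {f g : Fin n → ℕ} → (∀ i → f i ≤ g i) → total f ≤ total g
total-mono-≤ {zero} f≤g = z≤n
total-mono-≤ {suc n} f≤g = +-mono-≤ (f≤g zero) (total-mono-≤ (f≤g ∘ suc))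

total-mono-< : ∀ {n} {f g : Fin n → ℕ} → (∀ i → f i ≤ g i) → ∀ i → f i < g i → total f < total g
total-mono-< f≤g zero lt = +-mono-<-≤ lt (total-mono-≤ (f≤g ∘ suc))
total-mono-< f≤g (suc i) lt = +-mono-≤-< (f≤g zero) (total-mono-< (f≤g ∘ suc) i lt)

total-bound : ∀ {n} {f : Fin n → ℕ} {k} → (∀ i → f i ≤ k) → total f ≤ n * k
total-bound {zero} f≤k = z≤n
total-bound {suc n} f≤k = +-mono-≤ (f≤k zero) (total-bound (f≤k ∘ suc))

module _ {n : ℕ} {A : Set} where

  _[_≔_] : (Fin n → A) → Fin n → A → Fin n → A
  f [ a ≔ v ] = override (_≟ a) (const v) f

  updated : ∀ (f : Fin n → A) a {v} → (f [ a ≔ v ]) a ≡ v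
  updated f a {v} = override-in (_≟ a) (const v) f refl

  untouched : ∀ (f : Fin n → A) a {v x} → x ≢ a → (f [ a ≔ v ]) x ≡ f x
  untouched f a {v} = override-out (_≟ a) (const v) f

total-update : ∀ {n} {f g : Fin n → ℕ} a → (∀ {x} → x ≢ a → f x ≡ g x) → f a < g a → total f < total g
total-update {f = f} {g} a same lt = total-mono-< pointwise a lt
  where
  pointwise : ∀ x → f x ≤ g x
  pointwise x with x ≟ a
  ... | yes refl = <⇒≤ lt
  ... | no x≢a = ≤-reflexive (same x≢a)

collision? : ∀ {n} (f : Fin n → Fin n) → (∃ λ x → ∃ λ y → x ≢ y × f x ≡ f y) ⊎ Injective _≡_ _≡_ f
collision? f with any? (λ x → any? (λ y → ¬? (x ≟ y) ×-dec (f x ≟ f y)))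
... | yes collision = inj₁ collision
... | no none = inj₂ λ {x} {y} eq → decidable-stable (x ≟ y) (λ x≢y → none (x , y , x≢y , eq))

-- A step computes from the state alone, while the invariant speaks of the unknown profile. The
-- obligations of a `Step` are therefore quantified over PB.
module Search {n : ℕ} {State : Set} (μ : State → ℕ) (Inv : ProfileB n → State → Set)
              (Good : ProfileB n → Matching n → Set) where

  Sound : ProfileB n → State → State → Set
  Sound PB s s′ = Inv PB s′ × μ s′ < μ s

  data Step (s : State) : Set where
    halt    : ∀ M → (∀ {PB} → Inv PB s → Good PB M) → Step s
    goto    : ∀ s′ → (∀ {PB} → Inv PB s → Sound PB s s′) → Step s
    compare : ∀ b a₁ a₂ (s₁ s₂ : State) →
              (∀ {PB} → Inv PB s → a₁ ≢ a₂) →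
              (∀ {PB} → Inv PB s → PB b ⊢ a₁ ≺ a₂ → Sound PB s s₁) →
              (∀ {PB} → Inv PB s → PB b ⊢ a₂ ≺ a₁ → Sound PB s s₂) → Step s

  module _ (step : ∀ s → Step s) where

    explore : ℕ → State → Strategy n
    proceed : ℕ → ∀ {s} → Step s → Strategy n

    -- The output without fuel is arbitrary.
    explore zero s = done (↔-id _)
    explore (suc fuel) s = proceed fuel (step s)

    proceed fuel (halt M _) = done M
    proceed fuel (goto s′ _) = explore fuel s′
    proceed fuel (compare b a₁ a₂ s₁ s₂ _ _ _) =
      -- Every answer other than `a₂` is read as `a₁`; this is faithful since the two are distinct
      -- under the invariant.
      ask (prefer b a₁ a₂) (λ a → explore fuel (if does (a ≟ a₂) then s₂ else s₁))

    explore-length : ∀ fuel s PB → length (queriesOf (explore fuel s) PB) ≤ fuel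
    proceed-length : ∀ fuel {s} (r : Step s) PB → length (queriesOf (proceed fuel r) PB) ≤ suc fuel

    explore-length zero s PB = z≤n
    explore-length (suc fuel) s PB = proceed-length fuel (step s) PB

    proceed-length fuel (halt M _) PB = z≤n
    proceed-length fuel (goto s′ _) PB = m≤n⇒m≤1+n (explore-length fuel s′ PB)
    proceed-length fuel (compare b a₁ a₂ s₁ s₂ _ _ _) PB = s≤s (explore-length fuel _ PB)

    -- Each step lowers the potential, so a potential below the fuel keeps the run from reaching the
    -- arbitrary output.
    explore-good : ∀ fuel s PB → Inv PB s → μ s < fuel → Good PB (outputOf (explore fuel s) PB)
    proceed-good : ∀ fuel {s} (r : Step s) PB → Inv PB s → μ s ≤ fuel → Good PB (outputOf (proceed fuel r) PB)

    explore-good (suc fuel) s PB inv (s≤s μ≤) = proceed-good fuel (step s) PB inv μ≤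

    proceed-good fuel (halt M good) PB inv μ≤ = good inv
    proceed-good fuel (goto s′ sound) PB inv μ≤ with sound inv
    ... | inv′ , μ< = explore-good fuel s′ PB inv′ (<-≤-trans μ< μ≤)
    proceed-good fuel {s} (compare b a₁ a₂ s₁ s₂ distinct sound₁ sound₂) PB inv μ≤ =
      explore-good fuel _ PB (proj₁ sound) (<-≤-trans (proj₂ sound) μ≤)
      where
      sound : Sound PB s (if does (answer PB (prefer b a₁ a₂) ≟ a₂) then s₂ else s₁)
      sound with toℕ (to (PB b) a₂) <? toℕ (to (PB b) a₁)
      ... | yes a₂≺a₁ rewrite dec-true (a₂ ≟ a₂) refl = sound₂ inv a₂≺a₁
      ... | no a₂⊀a₁ rewrite dec-false (a₁ ≟ a₂) (distinct inv) =
        sound₁ inv (≺-connex (PB b) (distinct inv ∘ sym) a₂⊀a₁)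

-- The algorithm

data Status : Set where
  todo stacked final : Status

todo? : (z : Status) → Dec (z ≡ todo)
todo? todo = yes refl
todo? stacked = no λ ()
todo? final = no λ ()

module _ {n : ℕ} (P : Pref n) where

  -- Arbitrary when k is not a rank, i.e. n ≤ k.
  ranked : Fin n → ℕ → Fin n
  ranked junk k with k <? n
  ... | yes k<n = from P (fromℕ< k<n)
  ... | no _ = junk

  rank-ranked : ∀ {junk k} → k < n → toℕ (to P (ranked junk k)) ≡ k
  rank-ranked {k = k} k<n with k <? n
  ... | yes k<n′ = trans (cong toℕ (strictlyInverseˡ P _)) (toℕ-fromℕ< k<n′)
  ... | no k≮n = contradiction k<n k≮n

  ranked-rank : ∀ {junk k} x → k ≡ toℕ (to P x) → ranked junk k ≡ x
  ranked-rank x refl = to-injective P (toℕ-injective (rank-ranked (toℕ<n (to P x))))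

-- A pointer advance weighs 2, so that it also pays for a stacked agent becoming todo again.
statusWeight : Status → ℕ
statusWeight todo = 2
statusWeight stacked = 1
statusWeight final = 0

weight : ∀ {n} → (Fin n → ℕ) → (Fin n → Status) → Fin n → ℕ
weight {n} q st a = 2 * (n ∸ q a) + statusWeight (st a)

-- Every b strictly between the partner of a and rank q a of a's list has rejected a.  The stack L
-- has its top first: below the top, the candidate at rank q a is the partner of the entry above a
-- and is known to prefer a to that entry.
record Refinement (n : ℕ) : Set where
  constructor ⟨_,_,_,_⟩
  field
    M  : Matching n
    q  : Fin n → ℕ
    st : Fin n → Status
    L  : List (Fin n)

data State (n : ℕ) : Set where
  proposing : (Fin n → Fin n) → State n
  refining  : Refinement n → State n

-- The `suc` pays for the passage from the first phase to the second, which moves no agent.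
potential : ∀ {n} → State n → ℕ
potential {n} (proposing p) = suc (total (λ a → 2 * (n ∸ toℕ (p a))))
potential (refining ⟨ _ , q , st , _ ⟩) = total (weight q st)

-- Invariants of both phases, and the proposal phase.

module Invariants {n : ℕ} (PA : ProfileA n) where

  current : (Fin n → Fin n) → Fin n → Fin n
  current p a = from (PA a) (p a)

  -- The invariant of deferred acceptance: whoever a has passed is held by a present suitor better
  -- than a.
  Proposed : ProfileB n → (Fin n → Fin n) → Set
  Proposed PB p = ∀ a b → PA a ⊢ b ≺ current p a → ∃ λ x → current p x ≡ b × PB b ⊢ x ≺ a

  target : (Fin n → ℕ) → Fin n → Fin n
  target q a = ranked (PA a) a (q a)

  Follows : ProfileB n → Matching n → (Fin n → ℕ) → Fin n → Fin n → Set
  Follows PB M q x y = q y ≡ toℕ (to (PA y) (to M x)) × PB (to M x) ⊢ y ≺ x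

  record Refined (PB : ProfileB n) (M : Matching n) (q : Fin n → ℕ) (st : Fin n → Status)
                 (L : List (Fin n)) : Set where
    field
      stable   : Stable PA PB M
      ahead    : ∀ a → toℕ (to (PA a) (to M a)) < q a
      rejected : ∀ a b → PA a ⊢ to M a ≺ b → toℕ (to (PA a) b) < q a → PB b ⊢ from M b ≺ a
      linked   : Linked (Follows PB M q) L
      unique   : Unique L
      sound    : ∀ {a} → a ∈ L → st a ≡ stacked
      complete : ∀ {a} → st a ≡ stacked → a ∈ L
      settled  : ∀ {a} → st a ≡ final → StableMatchings.Final PA PB M a

  Inv : ProfileB n → State n → Set
  Inv PB (proposing p) = Proposed PB p
  Inv PB (refining ⟨ M , q , st , L ⟩) = Refined PB M q st L

  open Search potential Inv (λ PB M → BOptimal PA PB M) public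

  rank-current : ∀ p a → toℕ (to (PA a) (current p a)) ≡ toℕ (p a)
  rank-current p a = cong toℕ (strictlyInverseˡ (PA a) (p a))

  -- A loser at the end of its list never occurs (see not-last).
  advance : (Fin n → Fin n) → Fin n → Fin n → Fin n
  advance p a with suc (toℕ (p a)) <? n
  ... | yes more = p [ a ≔ fromℕ< more ]
  ... | no _ = p

  module _ {PB : ProfileB n} (p : Fin n → Fin n) (proposed : Proposed PB p) (w a : Fin n) (w≢a : w ≢ a)
           (same : current p w ≡ current p a) (w≺a : PB (current p a) ⊢ w ≺ a) where

    -- A suitor preferred to x may always be chosen different from a, since a can be replaced by w.
    dodge : ∀ {x b} → (∃ λ y → current p y ≡ b × PB b ⊢ y ≺ x) →
            ∃ λ y → y ≢ a × current p y ≡ b × PB b ⊢ y ≺ x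
    dodge {x} {b} (y , py≡b , y≺x) with y ≟ a
    ... | no y≢a = y , y≢a , py≡b , y≺x
    ... | yes refl = w , w≢a , trans same py≡b , <-trans (subst (λ z → PB z ⊢ w ≺ y) py≡b w≺a) y≺x

    behind : ∀ b → toℕ (to (PA a) b) < suc (toℕ (p a)) → ∃ λ y → y ≢ a × current p y ≡ b × PB b ⊢ y ≺ a
    behind b (s≤s rank≤) with b ≟ current p a
    ... | yes refl = w , w≢a , same , w≺a
    ... | no b≢ = dodge (proposed a b (subst (toℕ (to (PA a) b) <_) (sym (rank-current p a))
                    (≤∧≢⇒< rank≤ λ eq → b≢ (to-injective (PA a) (toℕ-injective (trans eq (sym (rank-current p a))))))))

    -- At the end of the list of a, every b would have a suitor other than a. These n suitors are
    -- distinct, so a would be among them.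
    not-last : suc (toℕ (p a)) < n
    not-last = ≰⇒> λ n≤ → missed (suitor n≤) (suitor-current n≤) (suitor-other n≤)
      where
      covered : n ≤ suc (toℕ (p a)) → ∀ b → ∃ λ y → y ≢ a × current p y ≡ b × PB b ⊢ y ≺ a
      covered n≤ b = behind b (<-≤-trans (toℕ<n (to (PA a) b)) n≤)
      suitor : n ≤ suc (toℕ (p a)) → Fin n → Fin n
      suitor n≤ b = proj₁ (covered n≤ b)
      suitor-other : ∀ n≤ b → suitor n≤ b ≢ a
      suitor-other n≤ b = proj₁ (proj₂ (covered n≤ b))
      suitor-current : ∀ n≤ b → current p (suitor n≤ b) ≡ b
      suitor-current n≤ b = proj₁ (proj₂ (proj₂ (covered n≤ b)))
      missed : (g : Fin n → Fin n) → (∀ b → current p (g b) ≡ b) → ¬ (∀ b → g b ≢ a)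
      missed g section other with injective⇒surjective {f = g}
        (λ {b} {b′} eq → trans (sym (section b)) (trans (cong (current p) eq) (section b′))) a
      ... | b , hit = other b hit

    module _ (v : Fin n) (v≡ : toℕ v ≡ suc (toℕ (p a))) where

      repoint : ∀ {x b} → (∃ λ y → y ≢ a × current p y ≡ b × PB b ⊢ y ≺ x) →
                ∃ λ y → current (p [ a ≔ v ]) y ≡ b × PB b ⊢ y ≺ x
      repoint (y , y≢a , py≡b , y≺x) = y , trans (cong (from (PA y)) (untouched p a y≢a)) py≡b , y≺x

      advance-proposed : Proposed PB (p [ a ≔ v ])
      advance-proposed x b b≺ with x ≟ a
      ... | yes refl = repoint (behind b (subst (toℕ (to (PA x) b) <_)
                         (trans (cong toℕ (strictlyInverseˡ (PA x) v)) v≡) b≺))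
      ... | no x≢a = repoint (dodge (proposed x b b≺))

      advance-potential : potential (proposing (p [ a ≔ v ])) < potential (proposing p)
      advance-potential = s≤s (total-update a (λ {x} x≢a → cong (λ k → 2 * (n ∸ toℕ k)) (untouched p a x≢a))
        (*-monoʳ-< 2 (subst (λ k → n ∸ k < n ∸ toℕ (p a)) (sym (trans (cong toℕ (updated p a)) v≡))
          (∸-monoʳ-< ≤-refl (<⇒≤ not-last)))))

    advance-sound : Sound PB (proposing p) (proposing (advance p a))
    advance-sound with suc (toℕ (p a)) <? n
    ... | yes more = advance-proposed (fromℕ< more) (toℕ-fromℕ< more) ,
                     advance-potential (fromℕ< more) (toℕ-fromℕ< more)
    ... | no last = contradiction not-last last

  module _ {PB : ProfileB n} (p : Fin n → Fin n) (proposed : Proposed PB p)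
           (M : Matching n) (matched : ∀ a → to M a ≡ current p a) where

    rank-matched : ∀ a → toℕ (to (PA a) (to M a)) ≡ toℕ (p a)
    rank-matched a = trans (cong (toℕ ∘ to (PA a)) (matched a)) (rank-current p a)

    -- The better suitor that b holds is its partner in M.
    proposed-stable : Stable PA PB M
    proposed-stable a b (b≢ , b≺ , a≺) with proposed a b (subst (PA a ⊢ b ≺_) (matched a) b≺)
    ... | x , px≡b , x≺a = <-asym x≺a (subst (PB b ⊢ a ≺_) (from-to M (trans (matched x) px≡b)) a≺)

    start-refining : Sound PB (proposing p) (refining ⟨ M , suc ∘ toℕ ∘ p , const todo , [] ⟩)
    start-refining = record
        { stable = proposed-stable
        ; ahead = λ a → s≤s (≤-reflexive (rank-matched a))
        ; rejected = λ { a b Ma≺b (s≤s b≤) →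
            contradiction (subst (_< toℕ (to (PA a) b)) (rank-matched a) Ma≺b) (≤⇒≯ b≤) }
        ; linked = []
        ; unique = []
        ; sound = λ ()
        ; complete = λ ()
        ; settled = λ ()
        } , s≤s (total-mono-≤ λ a → ≤-reflexive (weight≡ (toℕ (p a)) (toℕ<n (p a))))
      where
      weight≡ : ∀ k → k < n → 2 * (n ∸ suc k) + 2 ≡ 2 * (n ∸ k)
      weight≡ k k<n = begin
        2 * (n ∸ suc k) + 2   ≡⟨ +-comm (2 * (n ∸ suc k)) 2 ⟩
        2 + 2 * (n ∸ suc k)   ≡⟨ *-suc 2 (n ∸ suc k) ⟨
        2 * suc (n ∸ suc k)   ≡⟨ cong (2 *_) (sym (+-∸-assoc 1 k<n)) ⟩
        2 * (n ∸ k) ∎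
        where open ≡-Reasoning

-- The refinement phase: stack moves and rotations.

head∈prefix : {A : Set} {x : A} {xs : List A} → ∀ ps {c qs} → x ∷ xs ≡ ps ++ c ∷ qs → x ∈ ps ++ c ∷ []
head∈prefix [] refl = here refl
head∈prefix (p ∷ ps) refl = here refl

module Refining {n : ℕ} (PA : ProfileA n) where

  open Invariants PA
  open DecMembership (_≟_ {n}) using (_∈?_)

  module _ {PB : ProfileB n} {M : Matching n} {q : Fin n → ℕ} {st : Fin n → Status} {L : List (Fin n)}
           (refined : Refined PB M q st L) where
    open Refined refined

    -- Serves both to open a new stack and to put the partner of a successor on top of t.
    push-sound : ∀ c → st c ≡ todo → Linked (Follows PB M q) (c ∷ L) →
                 Sound PB (refining ⟨ M , q , st , L ⟩) (refining ⟨ M , q , st [ c ≔ stacked ] , c ∷ L ⟩)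
    push-sound c st≡ linked′ = record
        { stable = stable ; ahead = ahead ; rejected = rejected ; linked = linked′
        ; unique = ¬Any⇒All¬ L c∉L ∷ unique
        ; sound = sound′
        ; complete = λ {a} → complete′ a
        ; settled = λ {a} → settled′ a
        } , total-update c (λ {x} x≢c → cong (λ z → 2 * (n ∸ q x) + statusWeight z) (untouched st c x≢c)) lighter
      where
      c∉L : c ∉ L
      c∉L c∈L with trans (sym st≡) (sound c∈L)
      ... | ()
      sound′ : ∀ {a} → a ∈ c ∷ L → (st [ c ≔ stacked ]) a ≡ stacked
      sound′ (here refl) = updated st c
      sound′ (there a∈L) = trans (untouched st c (λ { refl → c∉L a∈L })) (sound a∈L)
      complete′ : ∀ a → (st [ c ≔ stacked ]) a ≡ stacked → a ∈ c ∷ L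
      complete′ a eq with a ≟ c
      ... | yes refl = here refl
      ... | no _ = there (complete eq)
      settled′ : ∀ a → (st [ c ≔ stacked ]) a ≡ final → StableMatchings.Final PA PB M a
      settled′ a eq with a ≟ c
      settled′ a () | yes _
      ... | no _ = settled eq
      lighter : weight q (st [ c ≔ stacked ]) c < weight q st c
      lighter rewrite updated st c {stacked} | st≡ = +-monoʳ-< (2 * (n ∸ q c)) ≤-refl

  module _ {PB : ProfileB n} {M : Matching n} {q : Fin n → ℕ} {st : Fin n → Status}
           {t : Fin n} {L : List (Fin n)} (refined : Refined PB M q st (t ∷ L)) where
    open Refined refined

    t∉L : t ∉ L
    t∉L = unique-disjoint (t ∷ []) unique (here refl)

    -- The entry below t, if any, has the partner of t as its successor and settles at its next
    -- comparison.
    settle-sound : StableMatchings.Final PA PB M t →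
                   Sound PB (refining ⟨ M , q , st , t ∷ L ⟩) (refining ⟨ M , q , st [ t ≔ final ] , L ⟩)
    settle-sound t-final = record
        { stable = stable ; ahead = ahead ; rejected = rejected
        ; linked = Linked.tail linked
        ; unique = unique-suffix (t ∷ []) unique
        ; sound = λ a∈L → trans (untouched st t (λ { refl → t∉L a∈L })) (sound (there a∈L))
        ; complete = λ {a} → complete′ a
        ; settled = λ {a} → settled′ a
        } , total-update t (λ {x} x≢t → cong (λ z → 2 * (n ∸ q x) + statusWeight z) (untouched st t x≢t)) lighter
      where
      complete′ : ∀ a → (st [ t ≔ final ]) a ≡ stacked → a ∈ L
      complete′ a eq with a ≟ t
      complete′ a () | yes _
      ... | no a≢t with complete eq
      ...   | here a≡t = contradiction a≡t a≢t
      ...   | there a∈L = a∈L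
      settled′ : ∀ a → (st [ t ≔ final ]) a ≡ final → StableMatchings.Final PA PB M a
      settled′ a eq with a ≟ t
      ... | yes refl = t-final
      ... | no _ = settled eq
      lighter : weight q (st [ t ≔ final ]) t < weight q st t
      lighter rewrite updated st t {final} | sound (here refl) = +-monoʳ-< (2 * (n ∸ q t)) ≤-refl

    rank-target : q t < n → toℕ (to (PA t) (target q t)) ≡ q t
    rank-target = rank-ranked (PA t)

    reject-sound : q t < n → PB (target q t) ⊢ from M (target q t) ≺ t →
                   Sound PB (refining ⟨ M , q , st , t ∷ L ⟩) (refining ⟨ M , q [ t ≔ suc (q t) ] , st , t ∷ L ⟩)
    reject-sound qt<n rejects = record
        { stable = stable
        ; ahead = ahead′
        ; rejected = rejected′
        ; linked = linked-map (λ _ y∈ (eq , better) → trans (untouched q t (λ { refl → t∉L y∈ })) eq , better)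
                     linked
        ; unique = unique ; sound = sound ; complete = complete ; settled = settled
        } , total-update t (λ {x} x≢t → cong (λ k → 2 * (n ∸ k) + statusWeight (st x)) (untouched q t x≢t)) lighter
      where
      ahead′ : ∀ a → toℕ (to (PA a) (to M a)) < (q [ t ≔ suc (q t) ]) a
      ahead′ a with a ≟ t
      ... | yes refl = m<n⇒m<1+n (ahead a)
      ... | no _ = ahead a
      rejected′ : ∀ a b → PA a ⊢ to M a ≺ b → toℕ (to (PA a) b) < (q [ t ≔ suc (q t) ]) a → PB b ⊢ from M b ≺ a
      rejected′ a b Ma≺b b< with a ≟ t
      ... | no _ = rejected a b Ma≺b b<
      ... | yes refl with b ≟ target q t
      ...   | yes refl = rejects
      ...   | no b≢ = rejected a b Ma≺b (≤∧≢⇒< (s≤s⁻¹ b<) λ eq →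
                        b≢ (sym (ranked-rank (PA t) b (sym eq))))
      lighter : weight (q [ t ≔ suc (q t) ]) st t < weight q st t
      lighter rewrite updated q t {suc (q t)} = +-monoˡ-< (statusWeight (st t)) (*-monoʳ-< 2 (∸-monoʳ-< ≤-refl qt<n))

    -- The pointer is strictly past the partner of t, so its target is held by another agent.
    distinct : q t < n → from M (target q t) ≢ t
    distinct qt<n eq = <-irrefl (trans (cong (toℕ ∘ to (PA t)) (trans (cong (to M) (sym eq)) (strictlyInverseˡ M _)))
                                       (rank-target qt<n)) (ahead t)

    exhausted-sound : ¬ (q t < n) →
                      Sound PB (refining ⟨ M , q , st , t ∷ L ⟩) (refining ⟨ M , q , st [ t ≔ final ] , L ⟩)
    exhausted-sound qt≮n = settle-sound (StableMatchings.exhausted⇒final PA PB M stable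
      λ b Mt≺b → rejected t b Mt≺b (<-≤-trans (toℕ<n (to (PA t) b)) (≮⇒≥ qt≮n)))

    module _ (qt<n : q t < n) (accepts : PB (target q t) ⊢ t ≺ from M (target q t)) where

      c : Fin n
      c = from M (target q t)

      successor-settled-sound : st c ≡ final →
        Sound PB (refining ⟨ M , q , st , t ∷ L ⟩) (refining ⟨ M , q , st [ t ≔ final ] , L ⟩)
      successor-settled-sound st≡ = settle-sound (StableMatchings.successor-final⇒final PA PB M stable
        (λ y Mt≺y y≺ → rejected t y Mt≺y (subst (toℕ (to (PA t) y) <_) (rank-target qt<n) y≺)) accepts (settled st≡))

      follows : Follows PB M q c t
      follows = trans (sym (rank-target qt<n)) (cong (toℕ ∘ to (PA t)) (sym (strictlyInverseˡ M _))) ,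
                subst (λ b → PB b ⊢ t ≺ c) (sym (strictlyInverseˡ M _)) accepts

      successor-pushed-sound : st c ≡ todo →
        Sound PB (refining ⟨ M , q , st , t ∷ L ⟩) (refining ⟨ M , q , st [ c ≔ stacked ] , c ∷ t ∷ L ⟩)
      successor-pushed-sound st≡ = push-sound refined c st≡ (follows ∷ linked)

      -- Here c is already on the stack: the entries from t down to c form a cycle, and `suf` is the
      -- lower part that is kept.
      module _ (ps suf : List (Fin n)) (split : t ∷ L ≡ ps ++ c ∷ suf) where

        cycle : List (Fin n)
        cycle = ps ++ c ∷ []

        split′ : t ∷ L ≡ cycle ++ suf
        split′ = trans split (sym (++-assoc ps (c ∷ []) suf))

        linked-cycle : Linked (Follows PB M q) (cycle ++ suf)
        linked-cycle = subst (Linked _) split′ linked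

        cycle#suf : ∀ {x} → x ∈ cycle → x ∉ suf
        cycle#suf = unique-disjoint cycle (subst Unique split′ unique)

        cycle⊆ : ∀ {x} → x ∈ cycle → x ∈ t ∷ L
        cycle⊆ x∈ = subst (_ ∈_) (sym split′) (∈-++⁺ˡ x∈)

        t∈cycle : t ∈ cycle
        t∈cycle = head∈prefix ps split

        in-range : ∀ {x} → x ∈ cycle → q x < n
        in-range x∈ = All.lookup (linked-all follower-in-range qt<n linked) (cycle⊆ x∈)
          where
          follower-in-range : ∀ {x y} → Follows PB M q x y → q y < n
          follower-in-range {x} {y} (eq , _) = subst (_< n) (sym eq) (toℕ<n (to (PA y) (to M x)))

        rank-target′ : ∀ {a} → a ∈ cycle → toℕ (to (PA a) (target q a)) ≡ q a
        rank-target′ {a} a∈ = rank-ranked (PA a) (in-range a∈)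

        -- The entry just below a points at the partner of a. For the bottom entry c it is the top
        -- t, which closes the cycle.
        predecessor : ∀ {a} → a ∈ cycle → ∃ λ x → x ∈ cycle × Follows PB M q a x
        predecessor a∈ with linked-next ps (subst (Linked _) split linked) a∈
        ... | inj₁ refl = t , t∈cycle , follows
        ... | inj₂ found = found

        rotation : StableMatchings.Rotation PA PB M (_∈ cycle) (target q)
        rotation = record
          { rejected = λ {a} a∈ b Ma≺b b≺ → rejected a b Ma≺b (subst (toℕ (to (PA a) b) <_) (rank-target′ a∈) b≺)
          ; suitor = suitor }
          where
          suitor : ∀ {a} → a ∈ cycle → ∃ λ x → x ∈ cycle × target q x ≡ to M a × PB (to M a) ⊢ x ≺ a
          suitor {a} a∈ with predecessor a∈
          ... | x , x∈ , eq , better = x , x∈ , ranked-rank (PA x) (to M a) eq , better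

        module _ (M′ : Matching n) (rotated : ∀ a → to M′ a ≡ override (_∈? cycle) (target q) (to M) a) where

          -- The new partner has rank `q a`, so the pointer moves just past it.
          q′ : Fin n → ℕ
          q′ = override (_∈? cycle) (suc ∘ q) q

          st′ : Fin n → Status
          st′ = override (_∈? cycle) (const todo) st

          moved : ∀ {a} → a ∈ cycle → toℕ (to (PA a) (to M′ a)) ≡ q a
          moved {a} a∈ = trans
            (cong (toℕ ∘ to (PA a)) (trans (rotated a) (override-in (_∈? cycle) (target q) (to M) a∈)))
            (rank-target′ a∈)

          kept : ∀ {a} → a ∉ cycle → to M′ a ≡ to M a
          kept {a} a∉ = trans (rotated a) (override-out (_∈? cycle) (target q) (to M) a∉)

          q-moved : ∀ {a} → a ∈ cycle → q′ a ≡ suc (q a)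
          q-moved = override-in (_∈? cycle) (suc ∘ q) q

          q-kept : ∀ {a} → a ∉ cycle → q′ a ≡ q a
          q-kept = override-out (_∈? cycle) (suc ∘ q) q

          st-moved : ∀ {a} → a ∈ cycle → st′ a ≡ todo
          st-moved = override-in (_∈? cycle) (const todo) st

          st-kept : ∀ {a} → a ∉ cycle → st′ a ≡ st a
          st-kept = override-out (_∈? cycle) (const todo) st

          unmoved : ∀ {a z} → z ≢ todo → st′ a ≡ z → a ∉ cycle × st a ≡ z
          unmoved {a} z≢ eq with a ∈? cycle
          ... | yes a∈ = contradiction (sym eq) z≢
          ... | no a∉ = a∉ , eq

          ahead′ : ∀ a → toℕ (to (PA a) (to M′ a)) < q′ a
          ahead′ a with a ∈? cycle
          ... | yes a∈ = s≤s (≤-reflexive (moved a∈))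
          ... | no a∉ = subst (λ b → toℕ (to (PA a) b) < q a) (sym (kept a∉)) (ahead a)

          rejected′ : ∀ a b → PA a ⊢ to M′ a ≺ b → toℕ (to (PA a) b) < q′ a → PB b ⊢ from M′ b ≺ a
          rejected′ a b M′a≺b b< with a ∈? cycle
          ... | yes a∈ = contradiction (subst (_< toℕ (to (PA a) b)) (moved a∈) M′a≺b) (≤⇒≯ (s≤s⁻¹ b<))
          ... | no a∉ = StableMatchings.rotated-rejects PA PB M (_∈? cycle) rotation M′ rotated
                          (rejected a b (subst (PA a ⊢_≺ b) (kept a∉) M′a≺b) b<)

          -- Links inside `suf` involve only partners and pointers of agents outside the cycle.
          linked′ : Linked (Follows PB M′ q′) suf
          linked′ = linked-map relink (linked-suffix cycle linked-cycle)
            where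
            relink : ∀ {x y} → x ∈ suf → y ∈ drop 1 suf → Follows PB M q x y → Follows PB M′ q′ x y
            relink {x} {y} x∈ y∈ (eq , better) =
              trans (q-kept (λ y∈c → cycle#suf y∈c (drop1⊆ y∈))) (trans eq (cong (toℕ ∘ to (PA y)) (sym same))) ,
              subst (λ b → PB b ⊢ y ≺ x) (sym same) better
              where
              same : to M′ x ≡ to M x
              same = kept (λ x∈c → cycle#suf x∈c x∈)

          rotate-sound : Sound PB (refining ⟨ M , q , st , t ∷ L ⟩) (refining ⟨ M′ , q′ , st′ , suf ⟩)
          rotate-sound = record
              { stable = StableMatchings.rotated-stable PA PB M (_∈? cycle) rotation M′ rotated stable
              ; ahead = ahead′
              ; rejected = rejected′
              ; linked = linked′
              ; unique = unique-suffix cycle (subst Unique split′ unique)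
              ; sound = λ a∈ → trans (st-kept (λ a∈c → cycle#suf a∈c a∈))
                                 (sound (subst (_ ∈_) (sym split′) (∈-++⁺ʳ cycle a∈)))
              ; complete = complete′
              ; settled = settled′
              } , total-mono-< lighter t (lighter-in t∈cycle)
            where
            complete′ : ∀ {a} → st′ a ≡ stacked → a ∈ suf
            complete′ eq with unmoved (λ ()) eq
            ... | a∉ , st≡ with ∈-++⁻ cycle (subst (_ ∈_) split′ (complete st≡))
            ...   | inj₁ a∈ = contradiction a∈ a∉
            ...   | inj₂ a∈ = a∈
            settled′ : ∀ {a} → st′ a ≡ final → StableMatchings.Final PA PB M′ a
            settled′ {a} eq with unmoved (λ ()) eq
            ... | a∉ , st≡ = λ M″ M″-stable worse →
              settled st≡ M″ M″-stable (subst (λ b → PA a ⊢ b ≺ to M″ a) (kept a∉) worse)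
            lighter-in : ∀ {a} → a ∈ cycle → weight q′ st′ a < weight q st a
            lighter-in {a} a∈ rewrite q-moved a∈ | st-moved a∈ | sound (cycle⊆ a∈) = begin-strict
              2 * (n ∸ suc (q a)) + 2 ≡⟨ +-comm (2 * (n ∸ suc (q a))) 2 ⟩
              2 + 2 * (n ∸ suc (q a)) ≡⟨ *-suc 2 (n ∸ suc (q a)) ⟨
              2 * suc (n ∸ suc (q a)) ≡⟨ cong (2 *_) (+-∸-assoc 1 (in-range a∈)) ⟨
              2 * (n ∸ q a)           <⟨ m<m+n (2 * (n ∸ q a)) (s≤s z≤n) ⟩
              2 * (n ∸ q a) + 1 ∎
              where open ≤-Reasoning
            lighter : ∀ a → weight q′ st′ a ≤ weight q st a
            lighter a = by-cases (a ∈? cycle)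
              where
              by-cases : Dec (a ∈ cycle) → weight q′ st′ a ≤ weight q st a
              by-cases (yes a∈) = <⇒≤ (lighter-in a∈)
              by-cases (no a∉) = ≤-reflexive (cong₂ (λ k z → 2 * (n ∸ k) + statusWeight z) (q-kept a∉) (st-kept a∉))

  -- The next state must not depend on the profile; its soundness is claimed for every profile in
  -- which the target accepts t.
  Accepted : Matching n → (Fin n → ℕ) → (Fin n → Status) → Fin n → List (Fin n) → State n → Set
  Accepted M q st t L s′ = ∀ {PB} → Refined PB M q st (t ∷ L) → q t < n →
    PB (target q t) ⊢ t ≺ from M (target q t) → Sound PB (refining ⟨ M , q , st , t ∷ L ⟩) s′

  accepted : ∀ M q st t L → ∃ (Accepted M q st t L)
  accepted M q st t L = by-successor (from M (target q t) ∈? (t ∷ L))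
    where
    by-status : from M (target q t) ∉ t ∷ L → ∀ z → st (from M (target q t)) ≡ z → ∃ (Accepted M q st t L)
    by-status _ todo st≡ = _ , λ refined qt<n accepts → successor-pushed-sound refined qt<n accepts st≡
    -- Here and in the last case of by-cycle the new state is arbitrary, since no profile leads there.
    by-status c∉ stacked st≡ = refining ⟨ M , q , st , t ∷ L ⟩ ,
      λ refined _ _ → contradiction (Refined.complete refined st≡) c∉
    by-status _ final st≡ = _ , λ refined qt<n accepts → successor-settled-sound refined qt<n accepts st≡

    by-cycle : ∀ ps suf → t ∷ L ≡ ps ++ from M (target q t) ∷ suf → ∃ (Accepted M q st t L)
    by-cycle ps suf split
      -- Injectivity of the rotated map follows from the unknown profile, so it is tested here, and
      -- a collision is refuted under the invariant.
      with collision? (override (_∈? (ps ++ from M (target q t) ∷ [])) (target q) (to M))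
    ... | inj₂ injective = _ , λ refined qt<n accepts →
            rotate-sound refined qt<n accepts ps suf split (bijection injective) (λ _ → refl)
    ... | inj₁ (_ , _ , x≢y , same) = refining ⟨ M , q , st , t ∷ L ⟩ , λ {PB} refined qt<n accepts →
            contradiction (StableMatchings.rotated-injective PA PB M (_∈? (ps ++ from M (target q t) ∷ []))
              (rotation refined qt<n accepts ps suf split) same) x≢y

    by-successor : Dec (from M (target q t) ∈ t ∷ L) → ∃ (Accepted M q st t L)
    by-successor (yes c∈) with ∈-∃++ c∈
    ... | ps , suf , split = by-cycle ps suf split
    by-successor (no c∉) = by-status c∉ (st (from M (target q t))) refl

  step : ∀ s → Step s
  step (proposing p) with collision? (current p)
  ... | inj₁ (a , a′ , a≢a′ , same) =
        compare (current p a) a a′ (proposing (advance p a′)) (proposing (advance p a)) (λ _ → a≢a′)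
          (λ {PB} proposed a≺a′ → advance-sound {PB} p proposed a a′ a≢a′ same
            (subst (λ b → PB b ⊢ a ≺ a′) same a≺a′))
          (λ {PB} proposed a′≺a → advance-sound {PB} p proposed a′ a (a≢a′ ∘ sym) (sym same) a′≺a)
  ... | inj₂ injective = goto _ (λ {PB} proposed → start-refining {PB} p proposed (bijection injective) (λ _ → refl))
  step (refining ⟨ M , q , st , [] ⟩) with any? (todo? ∘ st)
  ... | yes (a , st≡) = goto _ (λ refined → push-sound refined a st≡ [-])
  ... | no none = halt M (λ {PB} refined → StableMatchings.all-final⇒BOptimal PA PB M (Refined.stable refined)
          (λ a → all-settled refined a (st a) refl))
    where
    all-settled : ∀ {PB} → Refined PB M q st [] → ∀ a z → st a ≡ z → StableMatchings.Final PA PB M a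
    all-settled refined a todo st≡ = contradiction (a , st≡) none
    all-settled refined a final st≡ = Refined.settled refined st≡
    all-settled refined a stacked st≡ with Refined.complete refined st≡
    ... | ()
  step (refining ⟨ M , q , st , t ∷ L ⟩) with q t <? n
  ... | no qt≮n = goto _ (λ refined → exhausted-sound refined qt≮n)
  ... | yes qt<n = compare (target q t) (from M (target q t)) t
          (refining ⟨ M , q [ t ≔ suc (q t) ] , st , t ∷ L ⟩) (proj₁ (accepted M q st t L))
          (λ refined → distinct refined qt<n)
          (λ refined rejects → reject-sound refined qt<n rejects)
          (λ refined accepts → proj₂ (accepted M q st t L) refined qt<n accepts)

  module _ (top : Fin n) (top≡ : toℕ top ≡ 0) where

    start : State n
    start = proposing (const top)

    start-inv : ∀ PB → Inv PB start
    start-inv PB a b b≺ = contradiction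
      (subst (toℕ (to (PA a) b) <_) (trans (rank-current (const top) a) top≡) b≺) λ ()

    fuel : ℕ
    -- Each agent starts with weight at most `2 * n`. One unit is the `suc` in the potential, the
    -- other makes the inequality strict.
    fuel = suc (suc (n * (2 * n)))

    start-potential : potential start < fuel
    start-potential = s≤s (s≤s (total-bound {n} {f = λ _ → 2 * (n ∸ toℕ top)}
      (λ _ → *-monoʳ-≤ 2 (m∸n≤m n (toℕ top)))))

    strategy : Strategy n
    strategy = explore step fuel start

    strategy-BOptimal : ∀ PB → BOptimal PA PB (outputOf strategy PB)
    strategy-BOptimal PB = explore-good step fuel start PB (start-inv PB) start-potential

    strategy-length : ∀ PB → length (queriesOf strategy PB) ≤ fuel
    strategy-length PB = explore-length step fuel start PB

-- Correctness and the competitive ratio.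

output-agrees : ∀ {n} (S : Strategy n) {PB PB′ : ProfileB n} → Agrees (queriesOf S PB) PB PB′ →
                outputOf S PB′ ≡ outputOf S PB
output-agrees (done M) _ = refl
output-agrees (ask q k) {PB} {PB′} (eq ∷ agrees) =
  trans (cong (λ a → outputOf (k a) PB′) eq) (output-agrees (k (answer PB q)) agrees)

subsingleton-BOptimal : ∀ {n} → (∀ (x y : Fin n) → x ≡ y) → ∀ PA PB (M : Matching n) → BOptimal PA PB M
subsingleton-BOptimal same PA PB M = (λ a b (b≢ , _) → b≢ (same _ _)) , λ _ _ _ → inj₁ (same _ _)

-- For n at most 1 the empty query set suffices, so the bound allows no query at all.
algorithm : Algorithm
algorithm zero PA = done (↔-id _)
algorithm (suc zero) PA = done (↔-id _)
algorithm (suc (suc n)) PA = Refining.strategy PA zero refl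

algorithm-BOptimal : ∀ n PA PB → BOptimal PA PB (outputOf (algorithm n PA) PB)
algorithm-BOptimal zero PA PB = subsingleton-BOptimal (λ ()) PA PB (↔-id _)
algorithm-BOptimal (suc zero) PA PB = subsingleton-BOptimal (λ { zero zero → refl }) PA PB (↔-id _)
algorithm-BOptimal (suc (suc n)) PA PB = Refining.strategy-BOptimal PA zero refl PB

-- A profile with the same answers follows the same path of the decision tree, so the output is the
-- one computed for that profile.
algorithm-correct : Correct algorithm
algorithm-correct n PA PB PB′ agrees =
  subst (BOptimal PA PB′) (output-agrees (algorithm n PA) agrees) (algorithm-BOptimal n PA PB′)

-- As 2 is at most n * n, the left side is at most 3 * n * n; as l is at least 1, n is at most 2 *
-- l. This gives the factor 6.
quadratic≤linear : ∀ n l → 2 ≤ n → n ≤ suc l → 2 + n * (2 * n) ≤ 6 * n * l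
quadratic≤linear n l 2≤n n≤1+l = begin
  2 + n * (2 * n)         ≤⟨ +-monoˡ-≤ (n * (2 * n)) 2≤n*n ⟩
  n * n + n * (2 * n)     ≡⟨ *-distribˡ-+ n n (2 * n) ⟨
  n * (3 * n)             ≤⟨ *-monoʳ-≤ n (*-monoʳ-≤ 3 n≤2l) ⟩
  n * (3 * (2 * l))       ≡⟨ cong (n *_) (*-assoc 3 2 l) ⟨
  n * (6 * l)             ≡⟨ *-assoc n 6 l ⟨
  n * 6 * l               ≡⟨ cong (_* l) (*-comm n 6) ⟩
  6 * n * l               ∎
  where
  open ≤-Reasoning
  2≤n*n : 2 ≤ n * n
  2≤n*n = ≤-trans 2≤n (m≤m*n n n ⦃ >-nonZero (<-trans (s≤s z≤n) 2≤n) ⦄)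
  n≤2l : n ≤ 2 * l
  n≤2l = begin
    n           ≤⟨ n≤1+l ⟩
    1 + l       ≤⟨ +-monoˡ-≤ l (s≤s⁻¹ (≤-trans 2≤n n≤1+l)) ⟩
    l + l       ≡⟨ cong (l +_) (+-identityʳ l) ⟨
    2 * l       ∎

algorithm-competitive : CompetitiveLinear 6 algorithm
algorithm-competitive zero PA PB qs suffices = z≤n
algorithm-competitive (suc zero) PA PB qs suffices = z≤n
algorithm-competitive (suc (suc n)) PA PB qs suffices =
  ≤-trans (Refining.strategy-length PA zero refl PB)
    (quadratic≤linear (suc (suc n)) (length qs) (s≤s (s≤s z≤n)) (Suffices⇒n≤1+length PA PB qs suffices))

theorem9 : Σ ℕ λ c → Σ Algorithm λ alg → Correct alg × CompetitiveLinear c alg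
theorem9 = 6 , algorithm , algorithm-correct , algorithm-competitive
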